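{- 1. Every ccpBa (or c$\vee$cpBa) $\mathcal{A}$ is embeddable into the complex algebra $Up(\mathcal{F}_{\mathcal{A}})$ of the canonical frame $\mathcal{F}_{\mathcal{A}}$ of $\mathcal{A}$. 2. Every sub-normal frame (or sub-normal identity frame) $\mathcal{F}$ can be embedded into the canonical frame $\mathcal{F}_{Up(\mathcal{F})}$ of the complex algebra $Up(\mathcal{F})$ of $\mathcal{F}$.
   Context: A relatively pseudo-complemented (rpc) lattice is a lattice with a binary operation $\rightarrow$ satisfying $a\wedge x\leq b\Leftrightarrow x\leq a\rightarrow b$. A ccpBa is an algebra $(A,1,0,\vee,\wedge,\rightarrow,\neg,\sim)$ such that $(A,1,0,\vee,\wedge,\rightarrow)$ is a bounded rpc lattice and, for all $a\in A$, $\neg a=a\rightarrow 0$ and $\sim a=a\rightarrow(\neg\neg\sim 1)$. A c$\vee$cpBa is a ccpBa with $a\vee\sim a=1$ for all $a$. A sub-normal frame is $(W,\leq,Y_0)$ with $(W,\leq)$ a nonempty poset and $Y_0\subseteq W$ an upset such that for all $x\in W$: if for every $y\geq x$ there is $z\geq y$ with $z\in Y_0$, then $x\in Y_0$. It is a sub-normal identity frame if moreover for all $x,y\in W\setminus Y_0$, $x\leq y$ implies $y\leq x$. The complex algebra of $\mathcal{F}=(W,\leq,Y_0)$ is $Up(\mathcal{F})=(Up(W),W,\emptyset,\cup,\cap,\rightarrow,\neg,\sim)$, where $Up(W)$ is the set of upsets of $W$ and $U\rightarrow V=\{w:\forall v\geq w\,(v\in U\Rightarrow v\in V)\}$, $\neg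 U=U\rightarrow\emptyset$, $\sim U=U\rightarrow Y_0$; for a sub-normal (identity) frame it is a ccpBa (c$\vee$cpBa). The canonical frame of a ccpBa $\mathcal{A}$ is $\mathcal{F}_{\mathcal{A}}=(X_A,\subseteq,Y_0)$, where $X_A$ is the set of prime filters of $\mathcal{A}$ and $Y_0=\{P\in X_A:\ \sim1\in P\}$. An embedding of algebras is an order-preserving and order-reflecting map preserving all operations. An embedding of frames $(W,\leq,Y_0)\to(W',\leq',Y_0')$ is a map $f$ with $a\leq b\Leftrightarrow f(a)\leq'f(b)$ and $a\in Y_0\Leftrightarrow f(a)\in Y_0'$ for all $a,b\in W$. -}

module Defs where

open import Level using (Level; _⊔_; suc; Lift; lift; lower)
open import Algebra.Core using (Op₁)
import Data.Empty as Empty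
import Data.Unit as Unit
open import Data.Product using (∃; _×_; _,_; proj₁; proj₂)
open import Data.Sum using (_⊎_; inj₁; inj₂; [_,_])
open import Function.Bundles using (_⇔_)
open import Relation.Binary.Bundles using (Poset)
open import Relation.Binary.Definitions using (_Respects_)
open import Relation.Binary.Lattice.Bundles using (HeytingAlgebra)
open import Relation.Unary using (Pred; _∈_; _∉_; _⊆_; _≐_; _∪_; _∩_; Satisfiable)

-- The ambient set theory of the theorem is classical with choice.  Excluded
-- middle is the library's `ExcludedMiddle`; choice is supplied as Zorn's lemma.

IsChain : ∀ {c ℓ₁ ℓ₂ ℓ} (P : Poset c ℓ₁ ℓ₂) → Pred (Poset.Carrier P) ℓ → Set (c ⊔ ℓ₂ ⊔ ℓ)
IsChain P C = ∀ x y → x ∈ C → y ∈ C → x ≤ y ⊎ y ≤ x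
  where open Poset P using (_≤_)

ZornsLemma : ∀ c ℓ₁ ℓ₂ ℓ → Set (suc (c ⊔ ℓ₁ ⊔ ℓ₂ ⊔ ℓ))
ZornsLemma c ℓ₁ ℓ₂ ℓ =
  (P : Poset c ℓ₁ ℓ₂) → let open Poset P in
  ((C : Pred Carrier ℓ) → IsChain P C → ∃ λ u → ∀ x → x ∈ C → x ≤ u) →
  ∃ λ m → ∀ x → m ≤ x → x ≤ m

-- A bounded relatively pseudo-complemented lattice is a `HeytingAlgebra`
-- (`_⇨_` is →, `⊤` is 1, `⊥` is 0).  `Algebra` only fixes the signature of a
-- ccpBa; the equations for ⌐ (written ¬ on paper) and ∼ are in `IsCcpBa`.

record Algebra c ℓ₁ ℓ₂ : Set (suc (c ⊔ ℓ₁ ⊔ ℓ₂)) where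
  infix 8 ⌐_ ∼_
  field
    heytingAlgebra : HeytingAlgebra c ℓ₁ ℓ₂
  open HeytingAlgebra heytingAlgebra public
  field
    ⌐_ : Op₁ Carrier
    ∼_ : Op₁ Carrier

record IsCcpBa {c ℓ₁ ℓ₂} (A : Algebra c ℓ₁ ℓ₂) : Set (c ⊔ ℓ₁) where
  open Algebra A
  field
    ⌐-def : ∀ a → ⌐ a ≈ a ⇨ ⊥
    ∼-def : ∀ a → ∼ a ≈ a ⇨ (⌐ ⌐ ∼ ⊤)

record IsC∨cpBa {c ℓ₁ ℓ₂} (A : Algebra c ℓ₁ ℓ₂) : Set (c ⊔ ℓ₁) where
  open Algebra A
  field
    isCcpBa : IsCcpBa A
    ∨-∼     : ∀ a → a ∨ ∼ a ≈ ⊤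

record AlgebraEmbedding {a ℓ₁ ℓ₂ b ℓ₃ ℓ₄}
                        (A : Algebra a ℓ₁ ℓ₂) (B : Algebra b ℓ₃ ℓ₄) :
                        Set (a ⊔ ℓ₂ ⊔ b ⊔ ℓ₃ ⊔ ℓ₄) where
  private
    module A = Algebra A
    module B = Algebra B
  field
    f        : A.Carrier → B.Carrier
    ≤-embed  : ∀ x y → (x A.≤ y) ⇔ (f x B.≤ f y)
    ⊤-homo   : f A.⊤ B.≈ B.⊤
    ⊥-homo   : f A.⊥ B.≈ B.⊥
    ∨-homo   : ∀ x y → f (x A.∨ y) B.≈ f x B.∨ f y
    ∧-homo   : ∀ x y → f (x A.∧ y) B.≈ f x B.∧ f y
    ⇨-homo   : ∀ x y → f (x A.⇨ y) B.≈ f x B.⇨ f y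
    ⌐-homo   : ∀ x → f (A.⌐ x) B.≈ B.⌐ f x
    ∼-homo   : ∀ x → f (A.∼ x) B.≈ B.∼ f x

-- `Frame` is the bare data (W, ≤, Y₀).  Nonemptiness is in
-- `IsSubNormalFrame`, because the one-element algebra has no prime filters.

record Frame c ℓ₁ ℓ₂ ℓ : Set (suc (c ⊔ ℓ₁ ⊔ ℓ₂ ⊔ ℓ)) where
  field
    poset : Poset c ℓ₁ ℓ₂
  open Poset poset public
  field
    Y₀       : Pred Carrier ℓ
    Y₀-upset : Y₀ Respects _≤_

record IsSubNormalFrame {c ℓ₁ ℓ₂ ℓ} (F : Frame c ℓ₁ ℓ₂ ℓ) : Set (c ⊔ ℓ₂ ⊔ ℓ) where
  open Frame F
  field
    nonempty  : Carrier
    subNormal : ∀ x → (∀ y → x ≤ y → ∃ λ z → y ≤ z × z ∈ Y₀) → x ∈ Y₀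

record IsSubNormalIdentityFrame {c ℓ₁ ℓ₂ ℓ} (F : Frame c ℓ₁ ℓ₂ ℓ) : Set (c ⊔ ℓ₂ ⊔ ℓ) where
  open Frame F
  field
    isSubNormalFrame : IsSubNormalFrame F
    identity         : ∀ x y → x ∉ Y₀ → y ∉ Y₀ → x ≤ y → y ≤ x

record FrameEmbedding {c ℓ₁ ℓ₂ ℓ c′ ℓ₁′ ℓ₂′ ℓ′}
                      (F : Frame c ℓ₁ ℓ₂ ℓ) (G : Frame c′ ℓ₁′ ℓ₂′ ℓ′) :
                      Set (c ⊔ ℓ₂ ⊔ ℓ ⊔ c′ ⊔ ℓ₂′ ⊔ ℓ′) where
  private
    module F = Frame F
    module G = Frame G
  field
    f        : F.Carrier → G.Carrier
    ≤-embed  : ∀ x y → (x F.≤ y) ⇔ (f x G.≤ f y)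
    Y₀-embed : ∀ x → (x ∈ F.Y₀) ⇔ (f x ∈ G.Y₀)

-- Subsets are predicates.  Upsets live at the level c ⊔ ℓ₂ ⊔ ℓ, the least one
-- closed under U ⇨ V and containing Y₀; under excluded middle every predicate
-- is equivalent to one at any given level, so this choice excludes no subset.

module _ {c ℓ₁ ℓ₂ ℓ} (F : Frame c ℓ₁ ℓ₂ ℓ) where
  open Frame F

  record Upset : Set (suc (c ⊔ ℓ₂ ⊔ ℓ)) where
    field
      set   : Pred Carrier (c ⊔ ℓ₂ ⊔ ℓ)
      upset : set Respects _≤_

  open Upset

  infixr 5 _⇨ᵘ_
  _⇨ᵘ_ : Upset → Upset → Upset
  U ⇨ᵘ V = record
    { set   = λ w → ∀ v → w ≤ v → v ∈ set U → v ∈ set V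
    ; upset = λ w≤w′ h v w′≤v → h v (trans w≤w′ w′≤v)
    }

  ∅ᵘ : Upset
  ∅ᵘ = record { set = λ _ → Lift _ Empty.⊥ ; upset = λ _ () }

  Y₀ᵘ : Upset
  Y₀ᵘ = record
    { set   = λ w → Lift (c ⊔ ℓ₂) (w ∈ Y₀)
    ; upset = λ w≤v p → lift (Y₀-upset w≤v (lower p))
    }

  upsetHeytingAlgebra : HeytingAlgebra (suc (c ⊔ ℓ₂ ⊔ ℓ)) (c ⊔ ℓ₂ ⊔ ℓ) (c ⊔ ℓ₂ ⊔ ℓ)
  upsetHeytingAlgebra = record
    { Carrier = Upset
    ; _≈_     = λ U V → set U ≐ set V
    ; _≤_     = λ U V → set U ⊆ set V
    ; _∨_     = λ U V → record
        { set   = set U ∪ set V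
        ; upset = λ w≤v → [ (λ p → inj₁ (upset U w≤v p)) , (λ p → inj₂ (upset V w≤v p)) ]
        }
    ; _∧_     = λ U V → record
        { set   = set U ∩ set V
        ; upset = λ w≤v (p , q) → upset U w≤v p , upset V w≤v q
        }
    ; _⇨_     = _⇨ᵘ_
    ; ⊤       = record { set = λ _ → Lift _ Unit.⊤ ; upset = λ _ p → p }
    ; ⊥       = ∅ᵘ
    ; isHeytingAlgebra = record
      { isBoundedLattice = record
        { isLattice = record
          { isPartialOrder = record
            { isPreorder = record
              { isEquivalence = record
                { refl  = (λ p → p) , (λ p → p)
                ; sym   = λ (g , h) → h , g
                ; trans = λ (g , h) (g′ , h′) → (λ p → g′ (g p)) , (λ p → h (h′ p))
                }
              ; reflexive = proj₁
              ; trans     = λ g h p → h (g p)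
              }
            ; antisym = _,_
            }
          ; supremum = λ _ _ → inj₁ , inj₂ , λ _ g h → [ g , h ]
          ; infimum  = λ _ _ → proj₁ , proj₂ , λ _ g h p → g p , h p
          }
        ; maximum = λ _ _ → lift Unit.tt
        ; minimum = λ _ ()
        }
      ; exponential = λ U _ _ →
          (λ g p v w≤v q → g (upset U w≤v p , q)) ,
          (λ g (p , q) → g p _ refl q)
      }
    }

  complexAlgebra : Algebra (suc (c ⊔ ℓ₂ ⊔ ℓ)) (c ⊔ ℓ₂ ⊔ ℓ) (c ⊔ ℓ₂ ⊔ ℓ)
  complexAlgebra = record
    { heytingAlgebra = upsetHeytingAlgebra
    ; ⌐_ = λ U → U ⇨ᵘ ∅ᵘ
    ; ∼_ = λ U → U ⇨ᵘ Y₀ᵘ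
    }

module _ {c ℓ₁ ℓ₂} (A : Algebra c ℓ₁ ℓ₂) where
  open Algebra A

  record PrimeFilter : Set (suc (c ⊔ ℓ₁ ⊔ ℓ₂)) where
    field
      set      : Pred Carrier (c ⊔ ℓ₁ ⊔ ℓ₂)
      nonempty : Satisfiable set
      upset    : set Respects _≤_
      ∧-closed : ∀ a b → a ∈ set → b ∈ set → a ∧ b ∈ set
      proper   : ⊥ ∉ set
      prime    : ∀ a b → a ∨ b ∈ set → a ∈ set ⊎ b ∈ set

  open PrimeFilter

  canonicalFrame : Frame (suc (c ⊔ ℓ₁ ⊔ ℓ₂)) (c ⊔ ℓ₁ ⊔ ℓ₂) (c ⊔ ℓ₁ ⊔ ℓ₂) (c ⊔ ℓ₁ ⊔ ℓ₂)
  canonicalFrame = record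
    { poset = record
      { Carrier = PrimeFilter
      ; _≈_     = λ P Q → set P ≐ set Q
      ; _≤_     = λ P Q → set P ⊆ set Q
      ; isPartialOrder = record
        { isPreorder = record
          { isEquivalence = record
            { refl  = (λ p → p) , (λ p → p)
            ; sym   = λ (g , h) → h , g
            ; trans = λ (g , h) (g′ , h′) → (λ p → g′ (g p)) , (λ p → h (h′ p))
            }
          ; reflexive = proj₁
          ; trans     = λ g h p → h (g p)
          }
        ; antisym = _,_
        }
      }
    ; Y₀       = λ P → ∼ ⊤ ∈ set P
    ; Y₀-upset = λ P⊆Q p → P⊆Q p
    }

{-# OPTIONS --safe #-}
-- Part 1 is Stone's representation: a prime filter P lies in φ a when a ∈ P, and
-- the prime filter theorem shows that φ reflects order and preserves ⇨.  Since
-- ∼ a ≈ a ⇨ ∼ 1 in a ccpBa and Y₀ = φ (∼ 1), preservation of ∼ is a special case.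
-- Part 2 sends w to the prime filter of upsets containing w, and principal
-- upsets show that this map reflects order.  Sub-normality corresponds to
-- ⌐ ⌐ ∼ 1 ≈ ∼ 1, and the identity condition to a ∨ ∼ a ≈ 1.
module Submission where

open import Defs
open import Level using (Level; _⊔_; Lift; lift; lower)
open import Data.Product using (∃; Σ; _×_; _,_; proj₁; proj₂)
open import Data.Sum using (_⊎_; inj₁; inj₂; [_,_]; map)
open import Axiom.ExcludedMiddle using (ExcludedMiddle)
open import Function.Base using (_∘_)
open import Function.Bundles using (mk⇔)
open import Relation.Binary.Bundles using (Poset)
open import Relation.Binary.Definitions using (_Respects_)
import Relation.Binary.Construct.On as On
import Relation.Binary.Lattice.Properties.HeytingAlgebra as HeytingProperties
import Relation.Binary.Reasoning.Setoid as ≈-Reasoning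
open import Relation.Nullary using (¬_; yes; no; contradiction)
open import Relation.Nullary.Decidable using (True; toWitness; fromWitness; decidable-stable)
open import Relation.Unary using (Pred; _∈_; _∉_; _⊆_; _≐_)

-- Separated from nonemptiness because the canonical frame of the one-element algebra has no points.
SubNormal : ∀ {c ℓ₁ ℓ₂ ℓ} → Frame c ℓ₁ ℓ₂ ℓ → Set (c ⊔ ℓ₂ ⊔ ℓ)
SubNormal F = ∀ x → (∀ y → x ≤ y → ∃ λ z → y ≤ z × z ∈ Y₀) → x ∈ Y₀
  where open Frame F

Identity : ∀ {c ℓ₁ ℓ₂ ℓ} → Frame c ℓ₁ ℓ₂ ℓ → Set (c ⊔ ℓ₂ ⊔ ℓ)
Identity F = ∀ x y → x ∉ Y₀ → y ∉ Y₀ → x ≤ y → y ≤ x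
  where open Frame F

-- Filters of a Heyting algebra

module Filters {c ℓ₁ ℓ₂} (A : Algebra c ℓ₁ ℓ₂) where
  open Algebra A
  open HeytingProperties heytingAlgebra hiding (¬_)

  -- The whole carrier counts as a filter; properness is obtained later from an avoided element.
  record Filter : Set (Level.suc (c ⊔ ℓ₁ ⊔ ℓ₂)) where
    field
      set      : Pred Carrier (c ⊔ ℓ₁ ⊔ ℓ₂)
      ⊤-closed : ⊤ ∈ set
      upset    : set Respects _≤_
      ∧-closed : ∀ a b → a ∈ set → b ∈ set → a ∧ b ∈ set

    modusPonens : ∀ {a b} → a ∈ set → a ⇨ b ∈ set → b ∈ set
    modusPonens p q = upset ⇨-eval (∧-closed _ _ q p)

  filterPoset : Poset _ _ _
  filterPoset = record
    { Carrier = Filter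
    ; _≈_     = λ F G → Filter.set F ≐ Filter.set G
    ; _≤_     = λ F G → Filter.set F ⊆ Filter.set G
    ; isPartialOrder = record
      { isPreorder = record
        { isEquivalence = record
          { refl  = (λ p → p) , (λ p → p)
          ; sym   = λ (g , h) → h , g
          ; trans = λ (g , h) (g′ , h′) → g′ ∘ g , h ∘ h′
          }
        ; reflexive = proj₁
        ; trans     = λ g h → h ∘ g
        }
      ; antisym = _,_
      }
    }

  principal : Carrier → Filter
  principal a = record
    { set      = λ x → Lift (c ⊔ ℓ₁) (a ≤ x)
    ; ⊤-closed = lift (maximum a)
    ; upset    = λ x≤y (lift p) → lift (trans p x≤y)
    ; ∧-closed = λ _ _ (lift p) (lift q) → lift (∧-greatest p q)
    }

  -- The filter generated by F and a.
  adjoin : Filter → Carrier → Filter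
  adjoin F a = record
    { set      = λ x → a ⇨ x ∈ set
    ; ⊤-closed = upset y≤x⇨y ⊤-closed
    ; upset    = λ x≤y → upset (⇨ʳ-covariant x≤y)
    ; ∧-closed = λ x y p q → upset (⇨-distribˡ-∧-≥ a x y) (∧-closed _ _ p q)
    }
    where open Filter F

  module _ (F : Filter) (a : Carrier) where
    open Filter F

    ⊆-adjoin : set ⊆ Filter.set (adjoin F a)
    ⊆-adjoin = upset y≤x⇨y

    ∈-adjoin : a ∈ Filter.set (adjoin F a)
    ∈-adjoin = upset (reflexive (Eq.sym ⇨-unit)) ⊤-closed

  toFilter : PrimeFilter A → Filter
  toFilter P = record
    { set      = set
    ; ⊤-closed = upset (maximum _) (proj₂ nonempty)
    ; upset    = upset
    ; ∧-closed = ∧-closed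
    }
    where open PrimeFilter P

module _ (em   : ∀ {ℓ} → ExcludedMiddle ℓ)
         (zorn : ∀ {c ℓ₁ ℓ₂ ℓ} → ZornsLemma c ℓ₁ ℓ₂ ℓ) where

  byContradiction : ∀ {ℓ} {X : Set ℓ} → ¬ ¬ X → X
  byContradiction = decidable-stable em

  -- Excluded middle makes the universes of propositions impredicative.
  Resize : ∀ {a} ℓ → Set a → Set ℓ
  Resize ℓ X = Lift ℓ (True (em {P = X}))

  resize : ∀ {a ℓ} {X : Set a} → X → Resize ℓ X
  resize x = lift (fromWitness x)

  unresize : ∀ {a ℓ} {X : Set a} → Resize ℓ X → X
  unresize (lift t) = toWitness t

  -- Prime filters from Zorn's lemma

  module PrimeFilterTheorem {c ℓ₁ ℓ₂} (A : Algebra c ℓ₁ ℓ₂) where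
    open Algebra A
    open HeytingProperties heytingAlgebra hiding (¬_)
    open Filters A
    open Filter

    module _ (F : Filter) (b : Carrier) where

      Extension : Set _
      Extension = Σ Filter λ G → set F ⊆ set G × b ∉ set G

      extensionPoset : Poset _ _ _
      extensionPoset = On.poset {B = Extension} filterPoset proj₁

      module _ {ℓ} (C : Pred Extension ℓ) (chain : IsChain extensionPoset C) where

        -- F is included so that the empty chain is covered.
        InUnion : Carrier → Set _
        InUnion x = x ∈ set F ⊎ (∃ λ E → E ∈ C × x ∈ set (proj₁ E))

        ∧-union : ∀ x y → InUnion x → InUnion y → InUnion (x ∧ y)
        ∧-union x y (inj₁ p) (inj₁ q) = inj₁ (∧-closed F x y p q)
        ∧-union x y (inj₁ p) (inj₂ (E@(G , F⊆G , _) , E∈C , q)) =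
          inj₂ (E , E∈C , ∧-closed G x y (F⊆G p) q)
        ∧-union x y (inj₂ (E@(G , F⊆G , _) , E∈C , p)) (inj₁ q) =
          inj₂ (E , E∈C , ∧-closed G x y p (F⊆G q))
        -- The two members of the chain are comparable, so the meet is formed in the larger one.
        ∧-union x y (inj₂ (D , D∈C , p)) (inj₂ (E , E∈C , q)) with chain D E D∈C E∈C
        ... | inj₁ D⊆E = inj₂ (E , E∈C , ∧-closed (proj₁ E) x y (D⊆E p) q)
        ... | inj₂ E⊆D = inj₂ (D , D∈C , ∧-closed (proj₁ D) x y p (E⊆D q))

        upset-union : InUnion Respects _≤_
        upset-union x≤y (inj₁ p)             = inj₁ (upset F x≤y p)
        upset-union x≤y (inj₂ (E , E∈C , p)) = inj₂ (E , E∈C , upset (proj₁ E) x≤y p)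

        ∉-union : b ∉ set F → ¬ InUnion b
        ∉-union b∉F (inj₁ p)                      = b∉F p
        ∉-union b∉F (inj₂ ((_ , _ , b∉G) , _ , p)) = b∉G p

        union : b ∉ set F → Extension
        union b∉F =
          record
            -- `InUnion` quantifies over all extensions and so lives in a larger universe than
            -- `Filter` allows.
            { set      = λ x → Resize _ (InUnion x)
            ; ⊤-closed = resize (inj₁ (⊤-closed F))
            ; upset    = λ x≤y → resize ∘ upset-union x≤y ∘ unresize
            ; ∧-closed = λ x y p q → resize (∧-union x y (unresize p) (unresize q))
            } , resize ∘ inj₁ , ∉-union b∉F ∘ unresize

      -- If `x` and `y` both lie outside `M`, then maximality puts `x ⇨ b` and `y ⇨ b` in `M`, hence
      -- also `(x ∨ y) ⇨ b`; modus ponens with `x ∨ y` then yields `b`.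
      maximal-avoiding⇒prime : ((M , _) : Extension) →
        (∀ ((G , _) : Extension) → set M ⊆ set G → set G ⊆ set M) →
        ∀ x y → x ∨ y ∈ set M → x ∈ set M ⊎ y ∈ set M
      maximal-avoiding⇒prime (M , F⊆M , b∉M) maximal x y x∨y∈M
        with em {P = x ∈ set M} | em {P = y ∈ set M}
      ... | yes x∈M | _       = inj₁ x∈M
      ... | no _    | yes y∈M = inj₂ y∈M
      ... | no x∉M  | no y∉M  = contradiction
        (modusPonens M x∨y∈M
          (upset M (⇨-distribˡ-∨-∧-≥ x y b) (∧-closed M _ _ (⇨b∈M x∉M) (⇨b∈M y∉M))))
        b∉M
        where
        ⇨b∈M : ∀ {z} → z ∉ set M → z ⇨ b ∈ set M
        -- If `z ⇨ b` is not in `M`, then `adjoin M z` still avoids `b`, so by maximality it is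
        -- contained in `M`, and `z` with it.
        ⇨b∈M {z} z∉M = byContradiction λ z⇨b∉M → z∉M
          (maximal (adjoin M z , ⊆-adjoin M z ∘ F⊆M , z⇨b∉M) (⊆-adjoin M z) (∈-adjoin M z))

      -- A filter maximal among those containing `F` and avoiding `b` is prime, and it is proper
      -- because `⊥ ≤ b`.
      primeFilterTheorem : b ∉ set F →
        ∃ λ (P : PrimeFilter A) → set F ⊆ PrimeFilter.set P × b ∉ PrimeFilter.set P
      primeFilterTheorem b∉F
        with zorn extensionPoset (λ C chain →
          union {ℓ = Level.zero} C chain b∉F , λ E E∈C p → resize (inj₂ (E , E∈C , p)))
      ... | E@(M , F⊆M , b∉M) , maximal = record
        { set      = set M
        ; nonempty = ⊤ , ⊤-closed M
        ; upset    = upset M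
        ; ∧-closed = ∧-closed M
        ; proper   = b∉M ∘ upset M (minimum b)
        ; prime    = maximal-avoiding⇒prime E maximal
        } , F⊆M , b∉M

    ≰-separation : ∀ {a b} → ¬ a ≤ b →
      ∃ λ (P : PrimeFilter A) → a ∈ PrimeFilter.set P × b ∉ PrimeFilter.set P
    ≰-separation {a} {b} a≰b =
      let P , a⊆P , b∉P = primeFilterTheorem (principal a) b (a≰b ∘ lower)
      in P , a⊆P (lift refl) , b∉P

    -- By definition, `a ⇨ b ∉ P` says that the filter generated by `P` and `a` avoids `b`.
    ⇨-separation : ∀ (P : PrimeFilter A) {a b} → a ⇨ b ∉ PrimeFilter.set P →
      ∃ λ (Q : PrimeFilter A) → PrimeFilter.set P ⊆ PrimeFilter.set Q ×
              a ∈ PrimeFilter.set Q × b ∉ PrimeFilter.set Q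
    ⇨-separation P {a} {b} a⇨b∉P =
      let F = toFilter P
          Q , F+a⊆Q , b∉Q = primeFilterTheorem (adjoin F a) b a⇨b∉P
      in Q , F+a⊆Q ∘ ⊆-adjoin F a , F+a⊆Q (∈-adjoin F a) , b∉Q

  -- Complex algebras and the embedding of frames

  module ComplexAlgebra {c ℓ₁ ℓ₂ ℓ} (F : Frame c ℓ₁ ℓ₂ ℓ) where
    open Frame F
    private
      module Up = Algebra (complexAlgebra F)

    Y₀≈⌐⌐∼⊤ : SubNormal F → Y₀ᵘ F Up.≈ Up.⌐ Up.⌐ Up.∼ Up.⊤
    Y₀≈⌐⌐∼⊤ subNormal =
      (λ (lift p) v w≤v q → q v refl λ u v≤u _ → lift (Y₀-upset (trans w≤v v≤u) p)) ,
      -- A point of `⌐ ⌐ ∼ ⊤` has, above each of its successors, a point of `Y₀`; this is the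
      -- premise of sub-normality.
      λ p → lift (subNormal _ λ y w≤y → byContradiction λ ∄z →
        lower (p y w≤y λ v y≤v q → lift (∄z (v , y≤v , lower (q v refl _)))))

    isCcpBa : SubNormal F → IsCcpBa (complexAlgebra F)
    isCcpBa subNormal = record
      { ⌐-def = λ U → Up.Eq.refl {Up.⌐ U}
      ; ∼-def = λ U → HeytingProperties.⇨-cong Up.heytingAlgebra {U} {U} {Y₀ᵘ F} {Up.⌐ Up.⌐ Up.∼ Up.⊤}
          (Up.Eq.refl {U}) (Y₀≈⌐⌐∼⊤ subNormal)
      }

    -- Let `w ∉ U` and `w ≤ v` with `v ∈ U`. If `v ∉ Y₀`, then `w ∉ Y₀` as well, so `v ≤ w` and
    -- `w ∈ U`, a contradiction.
    ∨-∼ : Identity F → ∀ U → U Up.∨ Up.∼ U Up.≈ Up.⊤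
    ∨-∼ identity U = (λ _ → _) , λ {w} _ → split w
      where
      split : ∀ w → w ∈ Upset.set (U Up.∨ Up.∼ U)
      split w with em {P = w ∈ Upset.set U}
      ... | yes w∈U = inj₁ w∈U
      ... | no w∉U = inj₂ λ v w≤v v∈U → lift (byContradiction λ v∉Y₀ →
        w∉U (Upset.upset U (identity w v (v∉Y₀ ∘ Y₀-upset w≤v) v∉Y₀ w≤v) v∈U))

    isC∨cpBa : SubNormal F → Identity F → IsC∨cpBa (complexAlgebra F)
    isC∨cpBa subNormal identity = record
      { isCcpBa = isCcpBa subNormal
      ; ∨-∼     = ∨-∼ identity
      }

    point : Carrier → PrimeFilter (complexAlgebra F)
    point w = record
      { set      = λ U → Lift _ (w ∈ Upset.set U)
      ; nonempty = Up.⊤ , _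
      ; upset    = λ U⊆V (lift p) → lift (U⊆V p)
      ; ∧-closed = λ _ _ (lift p) (lift q) → lift (p , q)
      ; proper   = λ ()
      ; prime    = λ where
          _ _ (lift (inj₁ p)) → inj₁ (lift p)
          _ _ (lift (inj₂ q)) → inj₂ (lift q)
      }

    ↑ : Carrier → Upset F
    ↑ w = record
      { set   = λ v → Lift (c ⊔ ℓ) (w ≤ v)
      ; upset = λ u≤v (lift w≤u) → lift (trans w≤u u≤v)
      }

    frameEmbedding : FrameEmbedding F (canonicalFrame (complexAlgebra F))
    frameEmbedding = record
      { f        = point
      ; ≤-embed  = λ x y → mk⇔
          (λ x≤y {U} (lift p) → lift (Upset.upset U x≤y p))
          (λ x⊆y → lower (lower (x⊆y {↑ x} (lift (lift refl)))))
      -- `point x` lies in the canonical `Y₀` when every `v` above `x` is in `Y₀`; since `Y₀` is an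
      -- upset, this amounts to `x ∈ Y₀`.
      ; Y₀-embed = λ x → mk⇔
          (λ p → lift λ v x≤v _ → lift (Y₀-upset x≤v p))
          (λ (lift p) → lower (p x refl _))
      }

  -- Canonical frames and the embedding of algebras

  module CanonicalFrame {c ℓ₁ ℓ₂} {A : Algebra c ℓ₁ ℓ₂} (isCcpBa : IsCcpBa A) where
    open Algebra A
    open IsCcpBa isCcpBa
    open HeytingProperties heytingAlgebra hiding (¬_)
    open Filters A
    open PrimeFilterTheorem A
    open PrimeFilter
    private
      𝓕 = canonicalFrame A
      module Up = Algebra (complexAlgebra 𝓕)

    ⌐⌐∼⊤≤∼⊤ : ⌐ ⌐ ∼ ⊤ ≤ ∼ ⊤
    ⌐⌐∼⊤≤∼⊤ = trans y≤x⇨y (reflexive (Eq.sym (∼-def ⊤)))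

    ∼⊤≤⌐⌐∼⊤ : ∼ ⊤ ≤ ⌐ ⌐ ∼ ⊤
    ∼⊤≤⌐⌐∼⊤ = trans (∧-greatest (reflexive (∼-def ⊤)) (maximum _)) ⇨-eval

    -- `∼-def` at `⊤` gives `∼ ⊤ ≈ ⊤ ⇨ ⌐ ⌐ ∼ ⊤`, and the right side equals `⌐ ⌐ ∼ ⊤`.
    ∼≈⇨∼⊤ : ∀ a → ∼ a ≈ a ⇨ ∼ ⊤
    ∼≈⇨∼⊤ a = Eq.trans (∼-def a) (⇨-cong Eq.refl (antisym ⌐⌐∼⊤≤∼⊤ ∼⊤≤⌐⌐∼⊤))

    -- If `∼ ⊤ ∉ P`, then `⌐ ⌐ ∼ ⊤ ∉ P`, so some prime `Q` above `P` contains `⌐ ∼ ⊤`. A prime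
    -- filter above `Q` containing `∼ ⊤` would contain `⊥`.
    subNormal : SubNormal 𝓕
    subNormal P cofinal = byContradiction λ ∼⊤∉P →
      let Q , P⊆Q , ⌐∼⊤∈Q , _ = ⇨-separation P
            (∼⊤∉P ∘ upset P (trans (reflexive (Eq.sym (⌐-def (⌐ ∼ ⊤)))) ⌐⌐∼⊤≤∼⊤))
          R , Q⊆R , ∼⊤∈R = cofinal Q P⊆Q
      in proper R (Filter.modusPonens (toFilter R) ∼⊤∈R
           (upset R (reflexive (⌐-def (∼ ⊤))) (Q⊆R ⌐∼⊤∈Q)))

    -- For `a ∈ Q`, primeness puts `a` or `∼ a` in `P`; the latter would give `∼ ⊤ ∈ Q` by modus
    -- ponens.
    identity : (∀ a → a ∨ ∼ a ≈ ⊤) → Identity 𝓕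
    identity ∨-∼ P Q _ ∼⊤∉Q P⊆Q {a} a∈Q with
      prime P a (∼ a) (upset P (reflexive (Eq.sym (∨-∼ a))) (Filter.⊤-closed (toFilter P)))
    ... | inj₁ a∈P = a∈P
    ... | inj₂ ∼a∈P = contradiction
      (Filter.modusPonens (toFilter Q) a∈Q (upset Q (reflexive (∼≈⇨∼⊤ a)) (P⊆Q ∼a∈P)))
      ∼⊤∉Q

    φ : Carrier → Upset 𝓕
    φ a = record
      { set   = λ P → Lift _ (a ∈ set P)
      ; upset = λ P⊆Q (lift p) → lift (P⊆Q p)
      }

    φ-monotone : ∀ {a b} → a ≤ b → ∀ P → P ∈ Upset.set (φ a) → P ∈ Upset.set (φ b)
    φ-monotone a≤b P (lift p) = lift (upset P a≤b p)

    φ-cong : ∀ {a b} → a ≈ b → φ a Up.≈ φ b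
    φ-cong a≈b =
      (λ {P} → φ-monotone (reflexive a≈b) P) ,
      λ {P} → φ-monotone (reflexive (Eq.sym a≈b)) P

    φ-reflects-≤ : ∀ {a b} → φ a Up.≤ φ b → a ≤ b
    φ-reflects-≤ φa⊆φb = byContradiction λ a≰b →
      let P , a∈P , b∉P = ≰-separation a≰b
      in b∉P (lower (φa⊆φb {P} (lift a∈P)))

    φ-⊥ : φ ⊥ Up.≈ Up.⊥
    φ-⊥ = (λ {P} (lift p) → contradiction p (proper P)) , λ ()

    φ-⇨ : ∀ a b → φ (a ⇨ b) Up.≈ φ a Up.⇨ φ b
    φ-⇨ a b =
      (λ (lift p) Q P⊆Q (lift q) → lift (Filter.modusPonens (toFilter Q) q (P⊆Q p))) ,
      -- If `a ⇨ b ∉ P`, separation yields a prime filter above `P` with `a` but without `b`,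
      -- contradicting `h`.
      λ {P} h → lift (byContradiction λ a⇨b∉P →
        let Q , P⊆Q , a∈Q , b∉Q = ⇨-separation P a⇨b∉P
        in b∉Q (lower (h Q P⊆Q (lift a∈Q))))

    algebraEmbedding : AlgebraEmbedding A (complexAlgebra 𝓕)
    algebraEmbedding = record
      { f       = φ
      ; ≤-embed = λ _ _ → mk⇔ (λ a≤b {P} → φ-monotone a≤b P) φ-reflects-≤
      ; ⊤-homo  = (λ _ → _) , λ {P} _ → lift (Filter.⊤-closed (toFilter P))
      ; ⊥-homo  = φ-⊥
      ; ∨-homo  = λ a b →
          (λ {P} (lift p) → map lift lift (prime P a b p)) ,
          λ {P} → [ φ-monotone (x≤x∨y a b) P , φ-monotone (y≤x∨y a b) P ]
      ; ∧-homo  = λ a b →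
          (λ {P} p → φ-monotone (x∧y≤x a b) P p , φ-monotone (x∧y≤y a b) P p) ,
          λ {P} (lift p , lift q) → lift (∧-closed P a b p q)
      ; ⇨-homo  = φ-⇨
      ; ⌐-homo  = λ a → begin
          φ (⌐ a)           ≈⟨ φ-cong (⌐-def a) ⟩
          φ (a ⇨ ⊥)         ≈⟨ φ-⇨ a ⊥ ⟩
          φ a Up.⇨ φ ⊥      ≈⟨ UpProperties.⇨-cong {φ a} {φ a} {φ ⊥} {Up.⊥} (Up.Eq.refl {φ a}) φ-⊥ ⟩
          φ a Up.⇨ Up.⊥     ∎
      -- The chain may end at `φ a Up.⇨ φ (∼ ⊤)` because `φ (∼ ⊤)` is `Y₀` of the canonical frame by
      -- definition.
      ; ∼-homo  = λ a → begin
          φ (∼ a)           ≈⟨ φ-cong (∼≈⇨∼⊤ a) ⟩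
          φ (a ⇨ ∼ ⊤)       ≈⟨ φ-⇨ a (∼ ⊤) ⟩
          φ a Up.⇨ φ (∼ ⊤)  ∎
      }
      where
      module UpProperties = HeytingProperties Up.heytingAlgebra
      open ≈-Reasoning Up.setoid

-- Each target is shown to belong to the class of its source. On the frame side, the complex algebra
-- is first placed in its class of algebras, and the results on canonical frames are then applied to
-- it; `point` supplies nonemptiness.
theorem7p4 :
  (∀ {ℓ : Level} → ExcludedMiddle ℓ) →
  (∀ {c ℓ₁ ℓ₂ ℓ : Level} → ZornsLemma c ℓ₁ ℓ₂ ℓ) →
  ∀ {c ℓ₁ ℓ₂ ℓ : Level} →
  (((A : Algebra c ℓ₁ ℓ₂) → IsCcpBa A →
      IsCcpBa (complexAlgebra (canonicalFrame A)) ×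
      AlgebraEmbedding A (complexAlgebra (canonicalFrame A)))
   ×
   ((A : Algebra c ℓ₁ ℓ₂) → IsC∨cpBa A →
      IsC∨cpBa (complexAlgebra (canonicalFrame A)) ×
      AlgebraEmbedding A (complexAlgebra (canonicalFrame A))))
  ×
  (((F : Frame c ℓ₁ ℓ₂ ℓ) → IsSubNormalFrame F →
      IsSubNormalFrame (canonicalFrame (complexAlgebra F)) ×
      FrameEmbedding F (canonicalFrame (complexAlgebra F)))
   ×
   ((F : Frame c ℓ₁ ℓ₂ ℓ) → IsSubNormalIdentityFrame F →
      IsSubNormalIdentityFrame (canonicalFrame (complexAlgebra F)) ×
      FrameEmbedding F (canonicalFrame (complexAlgebra F))))
theorem7p4 em zorn =
  ( (λ A isCcpBa → let open CanonicalFrame em zorn isCcpBa in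
      ComplexAlgebra.isCcpBa em zorn (canonicalFrame A) subNormal , algebraEmbedding)
  , (λ A isC∨cpBa → let open IsC∨cpBa isC∨cpBa
                        open CanonicalFrame em zorn isCcpBa in
      ComplexAlgebra.isC∨cpBa em zorn (canonicalFrame A) subNormal (identity ∨-∼) , algebraEmbedding))
  , (λ F isSubNormal → subNormalCase F isSubNormal , ComplexAlgebra.frameEmbedding em zorn F)
  , (λ F isIdentity →
      let open IsSubNormalIdentityFrame isIdentity
          open IsSubNormalFrame isSubNormalFrame
          open ComplexAlgebra em zorn F
      in record
           { isSubNormalFrame = subNormalCase F isSubNormalFrame
           ; identity         = CanonicalFrame.identity em zorn (isCcpBa subNormal) (∨-∼ identity)
           } , frameEmbedding)
  where
  subNormalCase : ∀ {c ℓ₁ ℓ₂ ℓ} (F : Frame c ℓ₁ ℓ₂ ℓ) → IsSubNormalFrame F →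
                  IsSubNormalFrame (canonicalFrame (complexAlgebra F))
  subNormalCase F isSubNormal = record
    { nonempty  = point nonempty
    ; subNormal = CanonicalFrame.subNormal em zorn (isCcpBa subNormal)
    }
    where
    open IsSubNormalFrame isSubNormal
    open ComplexAlgebra em zorn F
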